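{- The calculus $\mathsf{MS^2IC}_u$ coincides with $\mathsf{MS^2IC}$, i.e., both calculi prove exactly the same formulas.
   Context: The language extends classical propositional logic with a binary connective $\rightsquigarrow$ (strict implication) and a unary connective $\Box$; $[\forall]\phi$ abbreviates $\top\rightsquigarrow\phi$ and $\Diamond$ abbreviates $\neg\Box\neg$. The symmetric strict implication calculus $\mathsf{S^2IC}$ consists of all substitution instances of classical propositional tautologies and of the axioms (A1) $(\bot\rightsquigarrow\phi)\wedge(\phi\rightsquigarrow\top)$; (A2) $[(\phi\vee\psi)\rightsquigarrow\chi]\leftrightarrow[(\phi\rightsquigarrow\chi)\wedge(\psi\rightsquigarrow\chi)]$; (A3) $[\phi\rightsquigarrow(\psi\wedge\chi)]\leftrightarrow[(\phi\rightsquigarrow\psi)\wedge(\phi\rightsquigarrow\chi)]$; (A4) $(\phi\rightsquigarrow\psi)\to(\phi\to\psi)$; (A5) $(\phi\rightsquigarrow\psi)\leftrightarrow(\neg\psi\rightsquigarrow\neg\phi)$; (A8) $[\forall]\phi\to[\forall][\forall]\phi$; (A9) $\neg[\forall]\phi\to[\forall]\neg[\forall]\phi$; (A10) $(\phi\rightsquigarrow\psi)\leftrightarrow[\forall](\phi\rightsquigarrow\psi)$; (A11) $[\forall]\phi\to(\neg[\forall]\phi\rightsquigarrow\bot)$, closed under modus ponens and the rule $\phi/[\forall]\phi$. The modal symmetric strict implication calculus $\mathsf{MS^2IC}$ extends $\mathsf{S^2IC}$ with the axioms (K) $\Box(\phi\to\psi)\to(\Box\phi\to\Box\psi)$ and (Add)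 $(\phi\rightsquigarrow\psi)\to(\Box\phi\rightsquigarrow\Box\psi)$, and the rule (N) $\phi/\Box\phi$. The calculus $\mathsf{MS^2IC}_u$ is obtained by adding to $\mathsf{MS^2IC}$ the $\Pi_2$-rules ($\rho$6): from $(\phi\rightsquigarrow p)\wedge(p\rightsquigarrow\psi)\to\chi$ infer $(\phi\rightsquigarrow\psi)\to\chi$; ($\rho$7): from $(p\rightsquigarrow\phi)\wedge p\to\chi$ infer $\phi\to\chi$; (UC): from $(p\rightsquigarrow\phi)\wedge\Box p\to\psi$ infer $\Box\phi\to\psi$; in each rule $p$ is a propositional letter not occurring in $\phi,\psi,\chi$. -}

module Defs where

open import Data.Nat using (ℕ)
open import Data.Bool using (Bool; true; false; not; _∧_; _∨_)
open import Data.Empty using (⊥)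
open import Data.Unit using (⊤)
open import Data.Product using (_×_)
open import Data.Sum using (_⊎_)
open import Relation.Binary.PropositionalEquality using (_≡_)
open import Relation.Nullary using (¬_)

infixr 4 _⇒_ _⇔'_
infixr 5 _∨'_
infixr 6 _∧'_
infix 7 _↝_

data Fm : Set where
  var  : ℕ → Fm
  ⊥'   : Fm
  ⊤'   : Fm
  ¬'_  : Fm → Fm
  _∧'_ : Fm → Fm → Fm
  _∨'_ : Fm → Fm → Fm
  _⇒_  : Fm → Fm → Fm
  _↝_  : Fm → Fm → Fm
  □_   : Fm → Fm

_⇔'_ : Fm → Fm → Fm
φ ⇔' ψ = (φ ⇒ ψ) ∧' (ψ ⇒ φ)

[∀]_ : Fm → Fm
[∀] φ = ⊤' ↝ φ

-- Boolean evaluation treating propositional letters, strict implications and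
-- boxed formulas as atoms.  A formula is a substitution instance of a classical
-- propositional tautology iff it is true under every such valuation.
eval : (Fm → Bool) → Fm → Bool
eval v (var p)  = v (var p)
eval v ⊥'       = false
eval v ⊤'       = true
eval v (¬' φ)   = not (eval v φ)
eval v (φ ∧' ψ) = eval v φ ∧ eval v ψ
eval v (φ ∨' ψ) = eval v φ ∨ eval v ψ
eval v (φ ⇒ ψ)  = not (eval v φ) ∨ eval v ψ
eval v (φ ↝ ψ)  = v (φ ↝ ψ)
eval v (□ φ)    = v (□ φ)

TautInstance : Fm → Set
TautInstance φ = (v : Fm → Bool) → eval v φ ≡ true

Occurs : ℕ → Fm → Set
Occurs p (var q)  = p ≡ q
Occurs p ⊥'       = ⊥
Occurs p ⊤'       = ⊥
Occurs p (¬' φ)   = Occurs p φ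
Occurs p (φ ∧' ψ) = Occurs p φ ⊎ Occurs p ψ
Occurs p (φ ∨' ψ) = Occurs p φ ⊎ Occurs p ψ
Occurs p (φ ⇒ ψ)  = Occurs p φ ⊎ Occurs p ψ
Occurs p (φ ↝ ψ)  = Occurs p φ ⊎ Occurs p ψ
Occurs p (□ φ)    = Occurs p φ

Fresh3 : ℕ → Fm → Fm → Fm → Set
Fresh3 p φ ψ χ = ¬ Occurs p φ × ¬ Occurs p ψ × ¬ Occurs p χ

-- Derivability.  The Bool index u selects the calculus:
--   u = false : MS²IC ;   u = true : MS²IC_u (with the Π₂-rules ρ6, ρ7, UC).
data _⊢_ (u : Bool) : Fm → Set where
  taut : ∀ {φ} → TautInstance φ → u ⊢ φ
  A1   : ∀ φ → u ⊢ ((⊥' ↝ φ) ∧' (φ ↝ ⊤'))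
  A2   : ∀ φ ψ χ → u ⊢ (((φ ∨' ψ) ↝ χ) ⇔' ((φ ↝ χ) ∧' (ψ ↝ χ)))
  A3   : ∀ φ ψ χ → u ⊢ ((φ ↝ (ψ ∧' χ)) ⇔' ((φ ↝ ψ) ∧' (φ ↝ χ)))
  A4   : ∀ φ ψ → u ⊢ ((φ ↝ ψ) ⇒ (φ ⇒ ψ))
  A5   : ∀ φ ψ → u ⊢ ((φ ↝ ψ) ⇔' ((¬' ψ) ↝ (¬' φ)))
  A8   : ∀ φ → u ⊢ (([∀] φ) ⇒ ([∀] ([∀] φ)))
  A9   : ∀ φ → u ⊢ ((¬' ([∀] φ)) ⇒ ([∀] (¬' ([∀] φ))))
  A10  : ∀ φ ψ → u ⊢ ((φ ↝ ψ) ⇔' ([∀] (φ ↝ ψ)))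
  A11  : ∀ φ → u ⊢ (([∀] φ) ⇒ ((¬' ([∀] φ)) ↝ ⊥'))
  K    : ∀ φ ψ → u ⊢ ((□ (φ ⇒ ψ)) ⇒ ((□ φ) ⇒ (□ ψ)))
  Add  : ∀ φ ψ → u ⊢ ((φ ↝ ψ) ⇒ ((□ φ) ↝ (□ ψ)))
  MP   : ∀ {φ ψ} → u ⊢ (φ ⇒ ψ) → u ⊢ φ → u ⊢ ψ
  Nec∀ : ∀ {φ} → u ⊢ φ → u ⊢ ([∀] φ)
  N    : ∀ {φ} → u ⊢ φ → u ⊢ (□ φ)
  ρ6   : u ≡ true → ∀ {φ ψ χ} p → Fresh3 p φ ψ χ →
         u ⊢ (((φ ↝ var p) ∧' (var p ↝ ψ)) ⇒ χ) → u ⊢ ((φ ↝ ψ) ⇒ χ)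
  ρ7   : u ≡ true → ∀ {φ χ} p → Fresh3 p φ χ χ →
         u ⊢ (((var p ↝ φ) ∧' var p) ⇒ χ) → u ⊢ (φ ⇒ χ)
  UC   : u ≡ true → ∀ {φ ψ} p → Fresh3 p φ ψ ψ →
         u ⊢ (((var p ↝ φ) ∧' (□ (var p))) ⇒ ψ) → u ⊢ ((□ φ) ⇒ ψ)

MS²IC⊢_ : Fm → Set
MS²IC⊢ φ = false ⊢ φ

MS²ICu⊢_ : Fm → Set
MS²ICu⊢ φ = true ⊢ φ

{-# OPTIONS --safe #-}
module Submission where

-- Provable equivalence is not a congruence for ↝ in MS²IC: for instance [∀] p ⇒ [∀] (p ∨' p) is not
-- derivable.  The Π₂-rules are therefore eliminated by a translation of derivations rather than through
-- Kripke models.  Given a letter p and a formula s, the translation _* replaces p by s and leaves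
-- p-free formulas alone.  A strict implication α ↝ β containing p is broken up along the axioms that
-- constrain it; what remains unconstrained becomes (α * ↝ β *) ∨' [∀] (α * ⇒ β *), weak enough to make
-- p ↝ s and s ↝ p provable after translation, yet still implying α * ⇒ β *.  Theorems go to theorems,
-- and taking s = φ in each Π₂-rule discharges the hypotheses on p.

open import Defs
open import Function.Bundles using (_⇔_; mk⇔)
open import Function.Base using (_∘_; id)
open import Data.Nat using (ℕ; _≟_)
open import Data.Bool using (Bool; true; false; not; if_then_else_; _∧_; _∨_)
open import Data.Product using (_,_; proj₁; proj₂)
open import Data.Sum using (inj₁; inj₂; [_,_]; swap)
open import Relation.Binary.PropositionalEquality
  using (_≡_; refl; sym; trans; cong; cong₂; subst; subst₂)
open import Relation.Nullary using (¬_; Dec; yes; no; does)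
open import Relation.Nullary.Decidable using (dec-true; dec-false; _⊎-dec_)

private variable
  α β γ δ : Fm

-- Propositional and modal reasoning inside the calculus.

infix 2 _⊩_

_⊩_ : Fm → Fm → Set
α ⊩ β = MS²IC⊢ (α ⇒ β)

⊩-const : MS²IC⊢ β → α ⊩ β
⊩-const {β} {α} b = MP (taut λ v → lem (eval v α) (eval v β)) b
  where
  lem : ∀ x y → not y ∨ (not x ∨ y) ≡ true
  lem true  true  = refl
  lem false true  = refl
  lem true  false = refl
  lem false false = refl

⊩-ap : α ⊩ β ⇒ γ → α ⊩ β → α ⊩ γ
⊩-ap {α} {β} {γ} f a = MP (MP (taut λ v → lem (eval v α) (eval v β) (eval v γ)) f) a
  where
  lem : ∀ x y z → not (not x ∨ (not y ∨ z)) ∨ (not (not x ∨ y) ∨ (not x ∨ z)) ≡ true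
  lem false y     z     = refl
  lem true  false z     = refl
  lem true  true  true  = refl
  lem true  true  false = refl

⊩-refl : α ⊩ α
⊩-refl {α} = taut λ v → lem (eval v α)
  where
  lem : ∀ x → not x ∨ x ≡ true
  lem true  = refl
  lem false = refl

⊩-trans : α ⊩ β → β ⊩ γ → α ⊩ γ
⊩-trans f g = ⊩-ap (⊩-const g) f

π₁ : α ∧' β ⊩ α
π₁ {α} {β} = taut λ v → lem (eval v α) (eval v β)
  where
  lem : ∀ x y → not (x ∧ y) ∨ x ≡ true
  lem true  true  = refl
  lem true  false = refl
  lem false y     = refl

π₂ : α ∧' β ⊩ β
π₂ {α} {β} = taut λ v → lem (eval v α) (eval v β)
  where
  lem : ∀ x y → not (x ∧ y) ∨ y ≡ true
  lem true  true  = refl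
  lem true  false = refl
  lem false y     = refl

pair : α ⊩ β ⇒ α ∧' β
pair {α} {β} = taut λ v → lem (eval v α) (eval v β)
  where
  lem : ∀ x y → not x ∨ (not y ∨ (x ∧ y)) ≡ true
  lem true  true  = refl
  lem true  false = refl
  lem false y     = refl

ι₁ : α ⊩ α ∨' β
ι₁ {α} {β} = taut λ v → lem (eval v α) (eval v β)
  where
  lem : ∀ x y → not x ∨ (x ∨ y) ≡ true
  lem true  y = refl
  lem false y = refl

ι₂ : β ⊩ α ∨' β
ι₂ {β} {α} = taut λ v → lem (eval v α) (eval v β)
  where
  lem : ∀ x y → not y ∨ (x ∨ y) ≡ true
  lem true  true  = refl
  lem true  false = refl
  lem false true  = refl
  lem false false = refl

⟨_,_⟩ : α ⊩ β → α ⊩ γ → α ⊩ β ∧' γ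
⟨ f , g ⟩ = ⊩-ap (⊩-trans f pair) g

∨-elim : α ⊩ γ → β ⊩ γ → α ∨' β ⊩ γ
∨-elim {α} {γ} {β} f g = MP (MP (taut λ v → lem (eval v α) (eval v β) (eval v γ)) f) g
  where
  lem : ∀ x y z → not (not x ∨ z) ∨ (not (not y ∨ z) ∨ (not (x ∨ y) ∨ z)) ≡ true
  lem true  y     false = refl
  lem true  true  true  = refl
  lem true  false true  = refl
  lem false true  true  = refl
  lem false true  false = refl
  lem false false z     = refl

curry : α ∧' β ⊩ γ → α ⊩ β ⇒ γ
curry {α} {β} {γ} = MP (taut λ v → lem (eval v α) (eval v β) (eval v γ))
  where
  lem : ∀ x y z → not (not (x ∧ y) ∨ z) ∨ (not x ∨ (not y ∨ z)) ≡ true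
  lem false y     z     = refl
  lem true  false z     = refl
  lem true  true  true  = refl
  lem true  true  false = refl

uncurry : α ⊩ β ⇒ γ → α ∧' β ⊩ γ
uncurry f = ⊩-ap (⊩-trans π₁ f) π₂

contraposition : (α ⇒ β) ⊩ (¬' β ⇒ ¬' α)
contraposition {α} {β} = taut λ v → lem (eval v α) (eval v β)
  where
  lem : ∀ x y → not (not x ∨ y) ∨ (not (not y) ∨ not x) ≡ true
  lem false true  = refl
  lem false false = refl
  lem true  true  = refl
  lem true  false = refl

¬¬-elim : ¬' ¬' α ⊩ α
¬¬-elim {α} = taut λ v → lem (eval v α)
  where
  lem : ∀ x → not (not (not x)) ∨ x ≡ true
  lem true  = refl
  lem false = refl

¬¬-intro : α ⊩ ¬' ¬' α
¬¬-intro {α} = taut λ v → lem (eval v α)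
  where
  lem : ∀ x → not x ∨ not (not x) ≡ true
  lem true  = refl
  lem false = refl

¬-elim : α ⊩ ¬' α ⇒ β
¬-elim {α} {β} = taut λ v → lem (eval v α) (eval v β)
  where
  lem : ∀ x y → not x ∨ (not (not x) ∨ y) ≡ true
  lem true  y = refl
  lem false y = refl

¬∧ : ¬' (α ∧' β) ⊩ ¬' α ∨' ¬' β
¬∧ {α} {β} = taut λ v → lem (eval v α) (eval v β)
  where
  lem : ∀ x y → not (not (x ∧ y)) ∨ (not x ∨ not y) ≡ true
  lem true  true  = refl
  lem true  false = refl
  lem false y     = refl

⊢⊤ : MS²IC⊢ ⊤'
⊢⊤ = taut λ _ → refl

⊥-least : ⊥' ⊩ α
⊥-least = taut λ _ → refl

⊩⊤ : α ⊩ ⊤'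
⊩⊤ = ⊩-const ⊢⊤

⊢∧ : MS²IC⊢ α → MS²IC⊢ β → MS²IC⊢ (α ∧' β)
⊢∧ a b = MP (MP pair a) b

⊩-contra : α ⊩ β → ¬' β ⊩ ¬' α
⊩-contra = MP contraposition

□-mono : α ⊩ β → □ α ⊩ □ β
□-mono f = MP (K _ _) (N f)

□-∧ : □ α ∧' □ β ⊩ □ (α ∧' β)
□-∧ = uncurry (⊩-trans (□-mono pair) (K _ _))

⇔-refl : MS²IC⊢ (α ⇔' α)
⇔-refl = ⊢∧ ⊩-refl ⊩-refl

⇔-sym : MS²IC⊢ (α ⇔' β) → MS²IC⊢ (β ⇔' α)
⇔-sym e = ⊢∧ (MP π₂ e) (MP π₁ e)

⇔-trans : MS²IC⊢ (α ⇔' β) → MS²IC⊢ (β ⇔' γ) → MS²IC⊢ (α ⇔' γ)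
⇔-trans e f = ⊢∧ (⊩-trans (MP π₁ e) (MP π₁ f)) (⊩-trans (MP π₂ f) (MP π₂ e))

∧-mono : α ⊩ β → γ ⊩ δ → α ∧' γ ⊩ β ∧' δ
∧-mono f g = ⟨ ⊩-trans π₁ f , ⊩-trans π₂ g ⟩

∧-cong : MS²IC⊢ (α ⇔' β) → MS²IC⊢ (γ ⇔' δ) → MS²IC⊢ ((α ∧' γ) ⇔' (β ∧' δ))
∧-cong e f = ⊢∧ (∧-mono (MP π₁ e) (MP π₁ f)) (∧-mono (MP π₂ e) (MP π₂ f))

∧-interchange : ∀ α β γ δ → MS²IC⊢ (((α ∧' β) ∧' (γ ∧' δ)) ⇔' ((α ∧' γ) ∧' (β ∧' δ)))
∧-interchange _ _ _ _ =
  ⊢∧ ⟨ ∧-mono π₁ π₁ , ∧-mono π₂ π₂ ⟩ ⟨ ∧-mono π₁ π₁ , ∧-mono π₂ π₂ ⟩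

-- Formulas whose truth value persists under `□`.

record Stable (α : Fm) : Set where
  constructor stable
  field
    persist : α ⊩ □ α
    persist¬ : ¬' α ⊩ □ (¬' α)
open Stable

-- `Add` sends `⊤' ↝ α` to `□ ⊤' ↝ □ α`; `A4` weakens this to a material implication, and `N`
-- supplies `□ ⊤'`.
[∀]⊩□ : [∀] α ⊩ □ α
[∀]⊩□ = ⊩-ap (⊩-trans (Add _ _) (A4 _ _)) (⊩-const (N ⊢⊤))

-- By `A10` a strict implication is equivalent to its own `[∀]`, and `A9` prefixes `[∀]` to a
-- negated `[∀]`; `[∀]⊩□` then turns the outer `[∀]` into a box in both cases.
↝-stable : Stable (α ↝ β)
↝-stable = stable
  (⊩-trans (MP π₁ (A10 _ _)) [∀]⊩□)
  (⊩-trans (⊩-contra (MP π₂ (A10 _ _)))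
    (⊩-trans (A9 _) (⊩-trans [∀]⊩□ (□-mono (⊩-contra (MP π₁ (A10 _ _)))))))

⊤-stable : Stable ⊤'
⊤-stable = stable (⊩-const (N ⊢⊤)) (taut λ _ → refl)

¬-stable : Stable α → Stable (¬' α)
¬-stable a = stable (persist¬ a) (⊩-trans ¬¬-elim (⊩-trans (persist a) (□-mono ¬¬-intro)))

∧-stable : Stable α → Stable β → Stable (α ∧' β)
∧-stable a b = stable
  (⊩-trans ⟨ ⊩-trans π₁ (persist a) , ⊩-trans π₂ (persist b) ⟩ □-∧)
  (⊩-trans ¬∧ (∨-elim (⊩-trans (persist¬ a) (□-mono (⊩-contra π₁)))
                      (⊩-trans (persist¬ b) (□-mono (⊩-contra π₂)))))

∨-stable : Stable α → Stable β → Stable (α ∨' β)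
∨-stable a b = stable
  (∨-elim (⊩-trans (persist a) (□-mono ι₁)) (⊩-trans (persist b) (□-mono ι₂)))
  (⊩-trans ⟨ ⊩-trans (⊩-contra ι₁) (persist¬ a) , ⊩-trans (⊩-contra ι₂) (persist¬ b) ⟩
           (⊩-trans □-∧ (□-mono ¬∨)))
  where
  ¬∨ : ¬' α ∧' ¬' β ⊩ ¬' (α ∨' β)
  ¬∨ {α} {β} = taut λ v → lem (eval v α) (eval v β)
    where
    lem : ∀ x y → not (not x ∧ not y) ∨ not (x ∨ y) ≡ true
    lem true  y     = refl
    lem false true  = refl
    lem false false = refl

-- Translating strict implications along the axioms.

occurs? : ∀ p φ → Dec (Occurs p φ)
occurs? p (var q)  = p ≟ q
occurs? p ⊥'       = no λ ()
occurs? p ⊤'       = no λ ()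
occurs? p (¬' φ)   = occurs? p φ
occurs? p (φ ∧' ψ) = occurs? p φ ⊎-dec occurs? p ψ
occurs? p (φ ∨' ψ) = occurs? p φ ⊎-dec occurs? p ψ
occurs? p (φ ⇒ ψ)  = occurs? p φ ⊎-dec occurs? p ψ
occurs? p (φ ↝ ψ)  = occurs? p φ ⊎-dec occurs? p ψ
occurs? p (□ φ)    = occurs? p φ

-- The shapes of (antecedent, consequent) on which some axiom constrains ↝; `leaf` covers the rest.
data View : Fm → Fm → Set where
  bot  : ∀ β → View ⊥' β
  or   : ∀ α α′ β → View (α ∨' α′) β
  top  : ∀ α → View α ⊤'
  and  : ∀ α β β′ → View α (β ∧' β′)
  neg  : ∀ α β → View (¬' α) (¬' β)
  box  : ∀ α β → View (□ α) (□ β)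
  all  : ∀ α β → View ⊤' (α ↝ β)
  nall : ∀ α β → View ⊤' (¬' (α ↝ β))
  alln : ∀ α β → View (¬' (α ↝ β)) ⊥'
  leaf : ∀ α β → View α β

-- The shapes overlap and earlier clauses win: `⊥'` or a disjunction on the left takes precedence
-- over `⊤'` or a conjunction on the right. So `A2` becomes reflexive once `p` occurs, whereas `A3`
-- and the `⊤'` half of `A1` need recursion through disjunctive antecedents.
view : ∀ α β → View α β
view ⊥' β                = bot β
view (α ∨' α′) β         = or α α′ β
view α ⊤'                = top α
view α (β ∧' β′)         = and α β β′
view (¬' α) (¬' β)       = neg α β
view (□ α) (□ β)         = box α β
view ⊤' (α ↝ β)          = all α β
view ⊤' (¬' (α ↝ β))     = nall α β
view (¬' (α ↝ β)) ⊥'     = alln α β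
view α β                 = leaf α β

module Translation (p : ℕ) (s : Fm) where

  infix 8 _*

  _*   : Fm → Fm
  -- The test for `p` is repeated at every recursive call, so the `p`-free pieces of a decomposed
  -- implication stay literal.
  Q    : Fm → Fm → Fm
  R    : ∀ α β → View α β → Fm

  var q *    = if does (p ≟ q) then s else var q
  ⊥' *       = ⊥'
  ⊤' *       = ⊤'
  (¬' φ) *   = ¬' (φ *)
  (φ ∧' ψ) * = φ * ∧' ψ *
  (φ ∨' ψ) * = φ * ∨' ψ *
  (φ ⇒ ψ) *  = φ * ⇒ ψ *
  (φ ↝ ψ) *  = Q φ ψ
  (□ φ) *    = □ (φ *)

  Q α β = if does (occurs? p (α ↝ β)) then R α β (view α β) else α ↝ β

  R .⊥' β (bot .β)                     = ⊤'
  R .(α ∨' α′) β (or α α′ .β)          = Q α β ∧' Q α′ β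
  R α .⊤' (top .α)                     = ⊤'
  R α .(β ∧' β′) (and .α β β′)         = Q α β ∧' Q α β′
  -- From here up to `leaf`, the value is the translation of the other side of `A5`, `Add`, `A10`,
  -- `A9` or `A11` respectively, so that side becomes reflexive after translation.
  R .(¬' α) .(¬' β) (neg α β)          = Q β α
  R .(□ α) .(□ β) (box α β)            = Q α β
  R .⊤' .(α ↝ β) (all α β)             = Q α β
  R .⊤' .(¬' (α ↝ β)) (nall α β)       = ¬' Q α β
  R .(¬' (α ↝ β)) .⊥' (alln α β)       = Q α β
  R α β (leaf .α .β)                   = (α * ↝ β *) ∨' [∀] (α * ⇒ β *)

  Q-free : ∀ α β → ¬ Occurs p (α ↝ β) → Q α β ≡ α ↝ β
  Q-free α β h = cong (if_then R α β (view α β) else (α ↝ β)) (dec-false (occurs? p (α ↝ β)) h)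

  Q-occurs : ∀ α β → Occurs p (α ↝ β) → Q α β ≡ R α β (view α β)
  Q-occurs α β h = cong (if_then R α β (view α β) else (α ↝ β)) (dec-true (occurs? p (α ↝ β)) h)

  *-free : ∀ φ → ¬ Occurs p φ → φ * ≡ φ
  *-free (var q) h  = cong (if_then s else var q) (dec-false (p ≟ q) h)
  *-free ⊥' h       = refl
  *-free ⊤' h       = refl
  *-free (¬' φ) h   = cong ¬'_ (*-free φ h)
  *-free (φ ∧' ψ) h = cong₂ _∧'_ (*-free φ (h ∘ inj₁)) (*-free ψ (h ∘ inj₂))
  *-free (φ ∨' ψ) h = cong₂ _∨'_ (*-free φ (h ∘ inj₁)) (*-free ψ (h ∘ inj₂))
  *-free (φ ⇒ ψ) h  = cong₂ _⇒_ (*-free φ (h ∘ inj₁)) (*-free ψ (h ∘ inj₂))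
  *-free (φ ↝ ψ) h  = Q-free φ ψ h
  *-free (□ φ) h    = cong □_ (*-free φ h)

  var-* : var p * ≡ s
  var-* = cong (if_then s else var p) (dec-true (p ≟ p) refl)

  Q-cases : ∀ (P : Fm → Set) α β → P (α ↝ β) → P (R α β (view α β)) → P (Q α β)
  Q-cases P α β free occ with does (occurs? p (α ↝ β))
  ... | true  = occ
  ... | false = free

  -- Stability of translated implications and the translation of `A4`.

  mutual
    -- Needed for the `box` case of `R⊩⇒`. The negative half of `Stable` carries the induction
    -- through `nall`, whose value is a negation.
    Q-stable : ∀ α β → Stable (Q α β)
    Q-stable α β = Q-cases Stable α β ↝-stable (R-stable α β (view α β))

    R-stable : ∀ α β (w : View α β) → Stable (R α β w)
    R-stable .⊥' β (bot .β)               = ⊤-stable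
    R-stable .(α ∨' α′) β (or α α′ .β)    = ∧-stable (Q-stable α β) (Q-stable α′ β)
    R-stable α .⊤' (top .α)               = ⊤-stable
    R-stable α .(β ∧' β′) (and .α β β′)   = ∧-stable (Q-stable α β) (Q-stable α β′)
    R-stable .(¬' α) .(¬' β) (neg α β)    = Q-stable β α
    R-stable .(□ α) .(□ β) (box α β)      = Q-stable α β
    R-stable .⊤' .(α ↝ β) (all α β)       = Q-stable α β
    R-stable .⊤' .(¬' (α ↝ β)) (nall α β) = ¬-stable (Q-stable α β)
    R-stable .(¬' (α ↝ β)) .⊥' (alln α β) = Q-stable α β
    R-stable α β (leaf .α .β)             = ∨-stable ↝-stable ↝-stable

  mutual
    Q⊩⇒ : ∀ α β → Q α β ⊩ α * ⇒ β *
    Q⊩⇒ α β with occurs? p (α ↝ β)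
    ... | yes o = subst (_⊩ α * ⇒ β *) (sym (Q-occurs α β o)) (R⊩⇒ α β (view α β))
    ... | no ¬o = subst₂ _⊩_ (sym (Q-free α β ¬o))
                    (cong₂ _⇒_ (sym (*-free α (¬o ∘ inj₁))) (sym (*-free β (¬o ∘ inj₂)))) (A4 α β)

    R⊩⇒ : ∀ α β (w : View α β) → R α β w ⊩ α * ⇒ β *
    R⊩⇒ .⊥' β (bot .β)               = ⊩-const ⊥-least
    R⊩⇒ .(α ∨' α′) β (or α α′ .β)    = curry (⊩-ap (⊩-trans π₂ (∨-elim
      (curry (⊩-ap (⊩-trans π₂ (⊩-trans π₁ (Q⊩⇒ α β))) π₁))
      (curry (⊩-ap (⊩-trans π₂ (⊩-trans π₂ (Q⊩⇒ α′ β))) π₁)))) π₁)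
    R⊩⇒ α .⊤' (top .α)               = ⊩-const ⊩⊤
    R⊩⇒ α .(β ∧' β′) (and .α β β′)   = curry
      ⟨ ⊩-ap (⊩-trans π₁ (⊩-trans π₁ (Q⊩⇒ α β))) π₂ , ⊩-ap (⊩-trans π₁ (⊩-trans π₂ (Q⊩⇒ α β′))) π₂ ⟩
    R⊩⇒ .(¬' α) .(¬' β) (neg α β)    = ⊩-trans (Q⊩⇒ β α) contraposition
    -- The value carries no box, so stability first supplies one; then the induction hypothesis is
    -- applied under `□`.
    R⊩⇒ .(□ α) .(□ β) (box α β)      =
      ⊩-trans (persist (Q-stable α β)) (⊩-trans (□-mono (Q⊩⇒ α β)) (K _ _))
    R⊩⇒ .⊤' .(α ↝ β) (all α β)       = curry π₁
    R⊩⇒ .⊤' .(¬' (α ↝ β)) (nall α β) = curry π₁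
    R⊩⇒ .(¬' (α ↝ β)) .⊥' (alln α β) = ¬-elim
    R⊩⇒ α β (leaf .α .β)             = ∨-elim (A4 _ _) (⊩-ap (A4 _ _) ⊩⊤)

  -- Preservation of theorems under the translation.

  Q-⊥ : ∀ β → MS²IC⊢ Q ⊥' β
  Q-⊥ β = Q-cases MS²IC⊢_ ⊥' β (MP π₁ (A1 β)) ⊢⊤

  *-free-or-occurs : ∀ θ → MS²IC⊢ θ → (Occurs p θ → MS²IC⊢ (θ *)) → MS²IC⊢ (θ *)
  *-free-or-occurs θ ⊢θ occ with occurs? p θ
  ... | yes o = occ o
  ... | no ¬o = subst MS²IC⊢_ (sym (*-free θ ¬o)) ⊢θ

  -- A `p`-free axiom instance is its own translation. Otherwise `occ` locates `p` in `α ↝ β`, so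
  -- the left side unfolds to `R`, while `γ *` can stay folded whether or not its pieces contain
  -- `p`.
  Q⇔-intro : ∀ α β γ → MS²IC⊢ ((α ↝ β) ⇔' γ) → (Occurs p γ → Occurs p (α ↝ β)) →
             MS²IC⊢ (R α β (view α β) ⇔' γ *) → MS²IC⊢ (Q α β ⇔' γ *)
  Q⇔-intro α β γ free occ ⊢R = *-free-or-occurs ((α ↝ β) ⇔' γ) free λ o →
    subst (λ q → MS²IC⊢ (q ⇔' γ *)) (sym (Q-occurs α β ([ [ id , occ ] , [ occ , id ] ] o))) ⊢R

  Q-∨ : ∀ α α′ β → MS²IC⊢ (Q (α ∨' α′) β ⇔' (Q α β ∧' Q α′ β))
  Q-∨ α α′ β = Q⇔-intro (α ∨' α′) β ((α ↝ β) ∧' (α′ ↝ β)) (A2 α α′ β)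
    [ [ inj₁ ∘ inj₁ , inj₂ ] , [ inj₁ ∘ inj₂ , inj₂ ] ] ⇔-refl

  mutual
    Q-∧ : ∀ α β β′ → MS²IC⊢ (Q α (β ∧' β′) ⇔' (Q α β ∧' Q α β′))
    Q-∧ α β β′ = Q⇔-intro α (β ∧' β′) ((α ↝ β) ∧' (α ↝ β′)) (A3 α β β′)
      [ [ inj₁ , inj₂ ∘ inj₁ ] , [ inj₁ , inj₂ ∘ inj₂ ] ] (R-∧ α β β′)

    R-∧ : ∀ α β β′ → MS²IC⊢ (R α (β ∧' β′) (view α (β ∧' β′)) ⇔' (Q α β ∧' Q α β′))
    -- Here `view` splits the antecedent first, so the four pieces must be regrouped by consequent.
    R-∧ (α ∨' α′) β β′ =
      ⇔-trans (∧-cong (Q-∧ α β β′) (Q-∧ α′ β β′))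
        (⇔-trans (∧-interchange (Q α β) (Q α β′) (Q α′ β) (Q α′ β′))
          (⇔-sym (∧-cong (Q-∨ α α′ β) (Q-∨ α α′ β′))))
    R-∧ ⊥' β β′       = ⊢∧ (⊩-const (⊢∧ (Q-⊥ β) (Q-⊥ β′))) ⊩⊤
    R-∧ (var _) β β′  = ⇔-refl
    R-∧ ⊤' β β′       = ⇔-refl
    R-∧ (¬' _) β β′   = ⇔-refl
    R-∧ (_ ∧' _) β β′ = ⇔-refl
    R-∧ (_ ⇒ _) β β′  = ⇔-refl
    R-∧ (_ ↝ _) β β′  = ⇔-refl
    R-∧ (□ _) β β′    = ⇔-refl

  mutual
    Q-⊤ : ∀ α → MS²IC⊢ Q α ⊤'
    Q-⊤ α = Q-cases MS²IC⊢_ α ⊤' (MP π₂ (A1 α)) (R-⊤ α)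

    R-⊤ : ∀ α → MS²IC⊢ R α ⊤' (view α ⊤')
    R-⊤ (α ∨' α′) = ⊢∧ (Q-⊤ α) (Q-⊤ α′)
    R-⊤ (var _)   = ⊢⊤
    R-⊤ ⊥'        = ⊢⊤
    R-⊤ ⊤'        = ⊢⊤
    R-⊤ (¬' _)    = ⊢⊤
    R-⊤ (_ ∧' _)  = ⊢⊤
    R-⊤ (_ ⇒ _)   = ⊢⊤
    R-⊤ (_ ↝ _)   = ⊢⊤
    R-⊤ (□ _)     = ⊢⊤

  Q-contra : ∀ α β → MS²IC⊢ (Q α β ⇔' Q (¬' β) (¬' α))
  Q-contra α β = ⇔-sym (Q⇔-intro (¬' β) (¬' α) (α ↝ β) (⇔-sym (A5 α β)) swap ⇔-refl)

  Q-[∀] : ∀ α β → MS²IC⊢ (Q α β ⇔' Q ⊤' (α ↝ β))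
  Q-[∀] α β = ⇔-sym (Q⇔-intro ⊤' (α ↝ β) (α ↝ β) (⇔-sym (A10 α β)) inj₂ ⇔-refl)

  Q-⇒-intro : ∀ γ α β → γ ⊩ α ↝ β → (Occurs p γ → Occurs p (α ↝ β)) →
              γ * ⊩ R α β (view α β) → γ * ⊩ Q α β
  Q-⇒-intro γ α β free occ ⊢R = *-free-or-occurs (γ ⇒ (α ↝ β)) free λ o →
    subst (λ q → γ * ⊩ q) (sym (Q-occurs α β ([ occ , id ] o))) ⊢R

  mutual
    -- At `all` and `nall` the goal is `θ *` itself. At a leaf, `Nec∀` applied to `⊤' ⇒ θ *` yields
    -- the second disjunct.
    Nec-Q : ∀ θ → MS²IC⊢ (θ *) → MS²IC⊢ Q ⊤' θ
    Nec-Q θ d with occurs? p θ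
    ... | yes _ = Nec-R θ (view ⊤' θ) d
    ... | no ¬o = Nec∀ (subst MS²IC⊢_ (*-free θ ¬o) d)

    Nec-R : ∀ θ (w : View ⊤' θ) → MS²IC⊢ (θ *) → MS²IC⊢ R ⊤' θ w
    Nec-R .⊤' (top .⊤') d                = ⊢⊤
    Nec-R .(θ ∧' θ′) (and .⊤' θ θ′) d    = ⊢∧ (Nec-Q θ (MP π₁ d)) (Nec-Q θ′ (MP π₂ d))
    Nec-R .(α ↝ β) (all α β) d           = d
    Nec-R .(¬' (α ↝ β)) (nall α β) d     = d
    Nec-R θ (leaf .⊤' .θ) d              = MP ι₂ (Nec∀ (⊩-const d))

  -- The translation commutes with the Boolean connectives, so it can be absorbed into the
  -- valuation; a tautology instance holds under that one too.
  eval-* : ∀ v φ → eval v (φ *) ≡ eval (λ ψ → eval v (ψ *)) φ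
  eval-* v (var q)  = refl
  eval-* v ⊥'       = refl
  eval-* v ⊤'       = refl
  eval-* v (¬' φ)   = cong not (eval-* v φ)
  eval-* v (φ ∧' ψ) = cong₂ _∧_ (eval-* v φ) (eval-* v ψ)
  eval-* v (φ ∨' ψ) = cong₂ _∨_ (eval-* v φ) (eval-* v ψ)
  eval-* v (φ ⇒ ψ)  = cong₂ (λ x y → not x ∨ y) (eval-* v φ) (eval-* v ψ)
  eval-* v (φ ↝ ψ)  = refl
  eval-* v (□ φ)    = refl

  ⊢-* : ∀ {φ} → MS²IC⊢ φ → MS²IC⊢ (φ *)
  ⊢-* {φ} (taut t) = taut λ v → trans (eval-* v φ) (t _)
  ⊢-* (A1 φ)       = ⊢∧ (Q-⊥ φ) (Q-⊤ φ)
  ⊢-* (A2 φ ψ χ)   = Q-∨ φ ψ χ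
  ⊢-* (A3 φ ψ χ)   = Q-∧ φ ψ χ
  ⊢-* (A4 φ ψ)     = Q⊩⇒ φ ψ
  ⊢-* (A5 φ ψ)     = Q-contra φ ψ
  ⊢-* (A8 φ)       = MP π₁ (Q-[∀] ⊤' φ)
  ⊢-* (A9 φ)       = Q-⇒-intro (¬' ([∀] φ)) ⊤' (¬' ([∀] φ)) (A9 φ) inj₂ ⊩-refl
  ⊢-* (A10 φ ψ)    = Q-[∀] φ ψ
  ⊢-* (A11 φ)      = Q-⇒-intro ([∀] φ) (¬' ([∀] φ)) ⊥' (A11 φ) inj₁ ⊩-refl
  ⊢-* (K φ ψ)      = K (φ *) (ψ *)
  ⊢-* (Add φ ψ)    = Q-⇒-intro (φ ↝ ψ) (□ φ) (□ ψ) (Add φ ψ) id ⊩-refl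
  ⊢-* (MP d e)     = MP (⊢-* d) (⊢-* e)
  ⊢-* (Nec∀ {φ} d) = Nec-Q φ (⊢-* d)
  ⊢-* (N d)        = N (⊢-* d)

  -- Strict implications with the replaced letter on one side.

  mutual
    -- With a letter as antecedent only `top`, `and` and `leaf` can arise, and at a leaf the second
    -- disjunct asks only for provability of the material implication.
    Q-varˡ : ∀ β → var p * ⊩ β * → MS²IC⊢ Q (var p) β
    Q-varˡ β d = subst MS²IC⊢_ (sym (Q-occurs (var p) β (inj₁ refl))) (R-varˡ β (view (var p) β) d)

    R-varˡ : ∀ β (w : View (var p) β) → var p * ⊩ β * → MS²IC⊢ R (var p) β w
    R-varˡ .⊤' (top ._) d              = ⊢⊤
    R-varˡ .(β ∧' β′) (and ._ β β′) d  = ⊢∧ (Q-varˡ β (⊩-trans d π₁)) (Q-varˡ β′ (⊩-trans d π₂))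
    R-varˡ β (leaf ._ .β) d            = MP ι₂ (Nec∀ d)

  mutual
    Q-varʳ : ∀ α → α * ⊩ var p * → MS²IC⊢ Q α (var p)
    Q-varʳ α d = subst MS²IC⊢_ (sym (Q-occurs α (var p) (inj₂ refl))) (R-varʳ α (view α (var p)) d)

    R-varʳ : ∀ α (w : View α (var p)) → α * ⊩ var p * → MS²IC⊢ R α (var p) w
    R-varʳ .⊥' (bot ._) d              = ⊢⊤
    R-varʳ .(α ∨' α′) (or α α′ ._) d   = ⊢∧ (Q-varʳ α (⊩-trans ι₁ d)) (Q-varʳ α′ (⊩-trans ι₂ d))
    R-varʳ α (leaf .α ._) d            = MP ι₂ (Nec∀ d)

  mutual
    -- This carries the antecedent `φ ↝ ψ` of `ρ6` to the translation of `var p ↝ ψ`. `A3` splits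
    -- conjunctions, and at a leaf the first disjunct is the hypothesis itself.
    ↝⊩Q-varˡ : ∀ β → var p * ↝ β * ⊩ Q (var p) β
    ↝⊩Q-varˡ β = subst (var p * ↝ β * ⊩_) (sym (Q-occurs (var p) β (inj₁ refl))) (↝⊩R-varˡ β (view (var p) β))

    ↝⊩R-varˡ : ∀ β (w : View (var p) β) → var p * ↝ β * ⊩ R (var p) β w
    ↝⊩R-varˡ .⊤' (top ._)             = ⊩⊤
    ↝⊩R-varˡ .(β ∧' β′) (and ._ β β′) =
      ⊩-trans (MP π₁ (A3 _ _ _)) (∧-mono (↝⊩Q-varˡ β) (↝⊩Q-varˡ β′))
    ↝⊩R-varˡ β (leaf ._ .β)           = ι₁

  ⊢-*-free : ∀ {α χ} → ¬ Occurs p χ → α ⊩ χ → α * ⊩ χ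
  ⊢-*-free {α} {χ} ∉χ d = subst (α * ⊩_) (*-free χ ∉χ) (⊢-* d)

-- Elimination of the Π₂-rules.

ρ6-admissible : ∀ {φ ψ χ} p → Fresh3 p φ ψ χ → (φ ↝ var p) ∧' (var p ↝ ψ) ⊩ χ → φ ↝ ψ ⊩ χ
ρ6-admissible {φ} {ψ} p (∉φ , ∉ψ , ∉χ) d =
  -- `φ ↝ var p` translates to a theorem because `φ *` and `var p *` are both `φ`; only `var p ↝ ψ`
  -- consumes `φ ↝ ψ`.
  ⊩-trans ⟨ ⊩-const (Q-varʳ φ (subst₂ _⊩_ (sym (*-free φ ∉φ)) (sym var-*) ⊩-refl))
          , subst₂ (λ α β → α ↝ β ⊩ Q (var p) ψ) var-* (*-free ψ ∉ψ) (↝⊩Q-varˡ ψ) ⟩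
          (⊢-*-free ∉χ d)
  where open Translation p φ

module _ {φ χ : Fm} (p : ℕ) (fresh : Fresh3 p φ χ χ) where
  -- Both rules share the premise `var p ↝ φ`, which this substitution makes a theorem; the
  -- remaining `var p` or `□ (var p)` becomes `φ` or `□ φ`.
  open Translation p φ

  private
    ∉φ = proj₁ fresh
    ∉χ = proj₁ (proj₂ fresh)

    Q-var-φ : MS²IC⊢ Q (var p) φ
    Q-var-φ = Q-varˡ φ (subst₂ _⊩_ (sym var-*) (sym (*-free φ ∉φ)) ⊩-refl)

  ρ7-admissible : (var p ↝ φ) ∧' var p ⊩ χ → φ ⊩ χ
  ρ7-admissible d = ⊩-trans ⟨ ⊩-const Q-var-φ , subst (φ ⊩_) (sym var-*) ⊩-refl ⟩ (⊢-*-free ∉χ d)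

  UC-admissible : (var p ↝ φ) ∧' □ (var p) ⊩ χ → □ φ ⊩ χ
  UC-admissible d =
    ⊩-trans ⟨ ⊩-const Q-var-φ , subst (λ α → □ φ ⊩ □ α) (sym var-*) ⊩-refl ⟩ (⊢-*-free ∉χ d)

eliminate-Π₂ : ∀ {φ} → MS²ICu⊢ φ → MS²IC⊢ φ
eliminate-Π₂ (taut t)         = taut t
eliminate-Π₂ (A1 φ)           = A1 φ
eliminate-Π₂ (A2 φ ψ χ)       = A2 φ ψ χ
eliminate-Π₂ (A3 φ ψ χ)       = A3 φ ψ χ
eliminate-Π₂ (A4 φ ψ)         = A4 φ ψ
eliminate-Π₂ (A5 φ ψ)         = A5 φ ψ
eliminate-Π₂ (A8 φ)           = A8 φ
eliminate-Π₂ (A9 φ)           = A9 φ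
eliminate-Π₂ (A10 φ ψ)        = A10 φ ψ
eliminate-Π₂ (A11 φ)          = A11 φ
eliminate-Π₂ (K φ ψ)          = K φ ψ
eliminate-Π₂ (Add φ ψ)        = Add φ ψ
eliminate-Π₂ (MP d e)         = MP (eliminate-Π₂ d) (eliminate-Π₂ e)
eliminate-Π₂ (Nec∀ d)         = Nec∀ (eliminate-Π₂ d)
eliminate-Π₂ (N d)            = N (eliminate-Π₂ d)
eliminate-Π₂ (ρ6 _ p fresh d) = ρ6-admissible p fresh (eliminate-Π₂ d)
eliminate-Π₂ (ρ7 _ p fresh d) = ρ7-admissible p fresh (eliminate-Π₂ d)
eliminate-Π₂ (UC _ p fresh d) = UC-admissible p fresh (eliminate-Π₂ d)

weaken : ∀ {φ} → MS²IC⊢ φ → MS²ICu⊢ φ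
weaken (taut t)    = taut t
weaken (A1 φ)      = A1 φ
weaken (A2 φ ψ χ)  = A2 φ ψ χ
weaken (A3 φ ψ χ)  = A3 φ ψ χ
weaken (A4 φ ψ)    = A4 φ ψ
weaken (A5 φ ψ)    = A5 φ ψ
weaken (A8 φ)      = A8 φ
weaken (A9 φ)      = A9 φ
weaken (A10 φ ψ)   = A10 φ ψ
weaken (A11 φ)     = A11 φ
weaken (K φ ψ)     = K φ ψ
weaken (Add φ ψ)   = Add φ ψ
weaken (MP d e)    = MP (weaken d) (weaken e)
weaken (Nec∀ d)    = Nec∀ (weaken d)
weaken (N d)       = N (weaken d)

theorem4p14 : (φ : Fm) → (MS²ICu⊢ φ) ⇔ (MS²IC⊢ φ)
theorem4p14 φ = mk⇔ eliminate-Π₂ weaken
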